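{- (i) Let $k\geq 3$ and let $G$ be a graph with $m^{\ast}(G)=k-1$ and girth at least $2k+2$. If $G$ contains the tree $R_k$ as a (not necessarily induced) subgraph, then $z(G)=k$. (ii) Let $k\geq 3$ and let $G$ be a graph on at least $(k-3)2^{k-1}+k+2$ vertices such that $m^{\ast}(G)=\delta(G)=k-1$ and the girth of $G$ is at least $2k+2$. Then $z(G)=k$.
   Context: All graphs are finite, nonempty, undirected, without loops or multiple edges. The girth of a graph is the length of its shortest cycle (an acyclic graph has girth $\infty$); $\delta(G)$ is the minimum degree. A proper vertex coloring of $G$ with $k$ colors is a surjective map $c:V(G)\to\{1,\dots,k\}$ with $c(x)\neq c(y)$ for every edge $xy$. In such a coloring, a vertex $v$ is a b-vertex if for every color $j\neq c(v)$ in $\{1,\dots,k\}$, $v$ has a neighbor of color $j$. A vertex $u$ is nice if for every color $j\neq c(u)$, $u$ has a neighbor of color $j$ that is a b-vertex. A Grundy coloring with $k$ colors is a proper coloring with $k$ colors such that for all $i<j$ in $\{1,\dots,k\}$, every vertex of color $j$ has a neighbor of color $i$. A $z$-coloring with $k$ colors is a Grundy coloring with $k$ colors that has a nice vertex of color $k$. $z(G)$ is the maximum number of colors in a $z$-coloring of $G$. $m^{\ast}(G)$ is the largest integer $k\ge 0$ such that some vertex of degree at least $k$ in $G$ has at least $k$ neighbors each of degree at least $k$ in $G$. For $k\ge 3$, $R_k$ is the unique (up to isomorphism) tree with the smallest number of vertices among trees $T$ with $z(T)=k$; it has $(k-3)2^{k-1}+k+2$ vertices. Explicitly, it is the following rooted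 tree, described together with its canonical $z$-coloring with $k$ colors. The root $u$ has color $k$ and exactly $k-1$ children $w_1,\dots,w_{k-1}$, where $w_i$ has color $i$. Each $w_i$ has exactly $k-2$ children, one of each color in $\{1,\dots,k-1\}\setminus\{i\}$. A child of $w_i$ of color $j$ has exactly one child of each color in $\{1,\dots,j-1\}\setminus\{i\}$ and no other children. Every vertex at distance at least $3$ from the root, of color $j$, has exactly $j-1$ children, one of each color in $\{1,\dots,j-1\}$. -}

module Defs where

open import Data.Fin.Base using (Fin; toℕ) renaming (_<_ to _<ᶠ_)
open import Data.List.Base using (List; []; _∷_; _++_; length; filter; allFin)
open import Data.List.Relation.Unary.Linked using (Linked)
open import Data.List.Relation.Unary.Unique.Propositional using (Unique)
open import Data.Nat.Base using (ℕ; suc; _≤_; _<_; NonZero)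
open import Data.Nat.Properties using (_≤?_)
open import Data.Product.Base using (Σ-syntax; ∃-syntax; _×_)
open import Data.Sum.Base using (_⊎_; inj₁; inj₂; swap)
open import Function.Definitions using (Injective; Surjective)
open import Level using (0ℓ)
open import Relation.Binary.Core using (Rel)
open import Relation.Binary.Construct.Add.Supremum.NonStrict _≤_ public
  using (_≤⁺_)
open import Relation.Binary.Definitions using (Decidable; Irreflexive; Symmetric)
open import Relation.Binary.PropositionalEquality.Core using (_≡_; _≢_; refl)
open import Relation.Nullary.Construct.Add.Supremum public
  using (_⁺; ⊤⁺; [_])
open import Relation.Nullary.Decidable.Core using (_×-dec_)
open import Relation.Nullary.Negation.Core using (¬_)
open import Relation.Unary using (Pred)
import Relation.Unary as U

IsMaximum : Pred ℕ 0ℓ → ℕ → Set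
IsMaximum P m = P m × (∀ {n} → P n → n ≤ m)

IsMinimum : Pred ℕ 0ℓ → ℕ → Set
IsMinimum P m = P m × (∀ {n} → P n → m ≤ n)

record SimpleGraph (V : Set) : Set₁ where
  infix 4 _~_
  field
    _~_    : Rel V 0ℓ
    sym    : Symmetric _~_
    irrefl : Irreflexive _≡_ _~_

infix 4 _⊑_

-- Containment as a not necessarily induced subgraph.
_⊑_ : ∀ {V W} → SimpleGraph V → SimpleGraph W → Set
_⊑_ {V} {W} H G =
  Σ[ f ∈ (V → W) ] Injective _≡_ _≡_ f × (∀ {x y} → x H.~ y → f x G.~ f y)
  where
  module H = SimpleGraph H
  module G = SimpleGraph G

record Graph : Set₁ where
  infix 4 _~?_
  field
    order       : ℕ
    nonempty    : NonZero order
    simpleGraph : SimpleGraph (Fin order)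

  V : Set
  V = Fin order

  open SimpleGraph simpleGraph public

  field
    _~?_ : Decidable _~_

  #_ : {P : Pred V 0ℓ} → U.Decidable P → ℕ
  # P? = length (filter P? (allFin order))

  deg : V → ℕ
  deg v = # (v ~?_)

module _ (G : Graph) where
  open Graph G

  infix 4 δ[_]≡_ girth[_]≡_ m*[_]≡_ z[_]≡_

  δ[_]≡_ : ℕ → Set
  δ[_]≡_ = IsMinimum (λ d → ∃[ v ] deg v ≡ d)

  record CycleOfLength (ℓ : ℕ) : Set where
    field
      start    : V
      rest     : List V
      distinct : Unique (start ∷ rest)
      closed   : Linked _~_ (start ∷ rest ++ start ∷ [])
      length≡  : length (start ∷ rest) ≡ ℓ
      3≤length : 3 ≤ ℓ

  data girth[_]≡_ : ℕ ⁺ → Set where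
    acyclic  : (∀ ℓ → ¬ CycleOfLength ℓ) → girth[_]≡_ ⊤⁺
    shortest : ∀ {ℓ} → IsMinimum CycleOfLength ℓ → girth[_]≡_ [ ℓ ]

  m*[_]≡_ : ℕ → Set
  m*[_]≡_ = IsMaximum λ k →
    ∃[ v ] k ≤ deg v × k ≤ # (λ w → (v ~? w) ×-dec (k ≤? deg w))

  -- The colours 1, …, k are represented by Fin k: an index i stands for the
  -- colour toℕ i + 1.
  module _ {k : ℕ} (c : V → Fin k) where

    ProperColoring : Set
    ProperColoring = Surjective _≡_ _≡_ c × (∀ {x y} → x ~ y → c x ≢ c y)

    BVertex : V → Set
    BVertex v = ∀ j → j ≢ c v → ∃[ w ] v ~ w × c w ≡ j

    Nice : V → Set
    Nice u = ∀ j → j ≢ c u → ∃[ w ] u ~ w × c w ≡ j × BVertex w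

    GrundyColoring : Set
    GrundyColoring =
      ProperColoring ×
      (∀ {i j} → i <ᶠ j → ∀ v → c v ≡ j → ∃[ w ] v ~ w × c w ≡ i)

    ZColoring : Set
    ZColoring = GrundyColoring × (∃[ u ] suc (toℕ (c u)) ≡ k × Nice u)

  z[_]≡_ : ℕ → Set
  z[_]≡_ = IsMaximum λ k → Σ[ c ∈ (V → Fin k) ] ZColoring c

-- Every non-root vertex of R k is `child v j _`, where v is its parent and j,
-- in 1, …, k - 1, is its colour in the canonical z-colouring (in which the root
-- has colour k).  `HasChild v j` says that v has a (unique) child of colour j;
-- its proofs are irrelevant so that they do not create further vertices.
mutual
  data RVertex (k : ℕ) : Set where
    root  : RVertex k
    child : (v : RVertex k) (j : ℕ) → .(HasChild v j) → RVertex k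

  HasChild : ∀ {k} → RVertex k → ℕ → Set
  HasChild {k} root                              j = 1 ≤ j × j < k
  HasChild {k} (child root i _)                  j = 1 ≤ j × j < k × j ≢ i
  HasChild (child (child root i _) j _)          l = 1 ≤ l × l < j × l ≢ i
  HasChild (child (child (child _ _ _) _ _) j _) l = 1 ≤ l × l < j

data _ChildOf_ {k : ℕ} : Rel (RVertex k) 0ℓ where
  childOf : ∀ {v j} .{p : HasChild v j} → child v j p ChildOf v

R : (k : ℕ) → SimpleGraph (RVertex k)
R k = record
  { _~_    = λ x y → x ChildOf y ⊎ y ChildOf x
  ; sym    = swap
  ; irrefl = λ where refl (inj₁ p) → not-own-child p
                     refl (inj₂ p) → not-own-child p
  }
  where
  not-own-child : ∀ {v : RVertex k} → ¬ (v ChildOf v)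
  not-own-child ()

{-# OPTIONS --safe #-}

-- In a z-colouring with n colours the nice vertex and its neighbours witness
-- m* ≥ n - 1, so z(G) ≤ m*(G) + 1 = k.
--
-- Conversely, two vertices of R k are at distance at most 2k, so a copy of R k
-- in G is induced, its canonical colouring is proper on it, and that colouring
-- is extended greedily to G: first to the vertices of degree at least k with a
-- neighbour in R k, then to the others of degree at least k, then to the rest.
-- Every vertex x meets at most k - 1 coloured neighbours.  In the first stage
-- these are in R k or adjacent to it, and the girth forces them towards pairwise
-- distinct branches of R k, of which there are k - 1: two vertices in one branch
-- are at distance at most 2k - 3, which would give a cycle through x of length at
-- most 2k + 1.  In the second stage they have degree at least k, so m*(G) = k - 1
-- bounds their number; in the third x itself has degree less than k.
--
-- If δ(G) = k - 1, a locally injective homomorphism from R k to G exists; it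
-- sends paths of R k, of length at most 2k, to non-backtracking walks, which have
-- distinct vertices by the girth condition, so it is injective.
module Submission where

open import Defs
open import Data.Empty using (⊥; ⊥-elim-irr)
open import Data.Fin.Base as Fin
  using (Fin; zero; suc; toℕ; fromℕ; fromℕ<; inject₁; inject≤; inject; combine; punchIn)
open import Data.Fin.Permutation.Components using (transpose; transpose-inverse)
import Data.Fin.Properties as Fin
open import Data.List.Base using (List; []; _∷_; _++_; length; take; map; lookup; filter; allFin)
open import Data.List.Membership.DecPropositional using () renaming (_∈?_ to member?)
open import Data.List.Membership.Propositional using (_∈_)
open import Data.List.Membership.Propositional.Properties
  using (∈-filter⁺; ∈-filter⁻; ∈-allFin; ∈-lookup)
import Data.List.Membership.Setoid.Properties as Membership
open import Data.List.Properties using (length-take; length-map)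
open import Data.List.Relation.Unary.All as All using ([]; _∷_)
open import Data.List.Relation.Unary.All.Properties using (¬Any⇒All¬)
open import Data.List.Relation.Unary.AllPairs using ([]; _∷_)
open import Data.List.Relation.Unary.Any using (here; there; index)
open import Data.List.Relation.Unary.Any.Properties using (lookup-index)
open import Data.List.Relation.Unary.Linked using (Linked; [-]; _∷_)
open import Data.List.Relation.Unary.Unique.Propositional using (Unique)
open import Data.List.Relation.Unary.Unique.Propositional.Properties
  using (take⁺; filter⁺; allFin⁺)
open import Data.Nat.Base
  using (ℕ; zero; suc; z≤n; s≤s; s≤s⁻¹; _≤_; _<_; _+_; _*_; _∸_; _^_; >-nonZero⁻¹)
open import Data.Nat.Properties
open import Data.Nat.Solver using (module +-*-Solver)
open import Data.Product.Base using (Σ-syntax; ∃-syntax; ∃; _×_; _,_; proj₁; proj₂)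
open import Data.Sum.Base as Sum using (_⊎_; inj₁; inj₂; swap)
open import Data.Vec.Functional using (updateAt)
open import Data.Vec.Functional.Properties using (updateAt-updates; updateAt-minimal)
open import Function.Base using (_∘_; const; id)
open import Function.Definitions using (Injective)
open import Level using (0ℓ)
open import Relation.Binary.Construct.Add.Supremum.NonStrict _≤_ using ([≤]-injective)
open import Relation.Binary.Core using (Rel; _⇒_)
open import Relation.Binary.Definitions
  using (DecidableEquality; Symmetric; tri<; tri≈; tri>)
open import Relation.Binary.PropositionalEquality
  using (_≡_; _≢_; refl; sym; trans; cong; subst; ≢-sym; setoid)
open import Relation.Nullary using (¬_; Dec; yes; no; contradiction)
open import Relation.Nullary.Decidable
  using (map′; recompute; ¬?; _×-dec_; _⊎-dec_; dec-true; decidable-stable)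
open import Relation.Unary using (Pred)
import Relation.Unary as U

-- Walks, paths and loop erasure.

infixr 5 _∷_

-- The index n of a walk is only an upper bound on its length.
data Walk {A : Set} (S : Rel A 0ℓ) : ℕ → Rel A 0ℓ where
  []  : ∀ {n a} → Walk S n a a
  _∷_ : ∀ {n a b c} → S a b → Walk S n b c → Walk S (suc n) a c

data Path {A : Set} (S : Rel A 0ℓ) : A → List A → A → Set where
  []  : ∀ {a} → Path S a [] a
  _∷_ : ∀ {a b c xs} → S a b → Path S b xs c → Path S a (b ∷ xs) c

module _ {A : Set} {S : Rel A 0ℓ} where

  weaken : ∀ {m n a b} → m ≤ n → Walk S m a b → Walk S n a b
  weaken m≤n       []      = []
  weaken (s≤s m≤n) (s ∷ w) = s ∷ weaken m≤n w

  infixr 5 _++ʷ_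
  _++ʷ_ : ∀ {m n a b c} → Walk S m a b → Walk S n b c → Walk S (m + n) a c
  []      ++ʷ v = weaken (m≤n+m _ _) v
  (s ∷ w) ++ʷ v = s ∷ (w ++ʷ v)

  reverseʷ : Symmetric S → ∀ {n a b} → Walk S n a b → Walk S n b a
  reverseʷ symS []              = []
  reverseʷ symS (_∷_ {n} s w) =
    weaken (≤-reflexive (+-comm n 1)) (reverseʷ symS w ++ʷ (symS s ∷ []))

  mapʷ : ∀ {B : Set} {T : Rel B 0ℓ} (f : A → B) → (∀ {x y} → S x y → T (f x) (f y)) →
         ∀ {n a b} → Walk S n a b → Walk T n (f a) (f b)
  mapʷ f S⇒T []      = []
  mapʷ f S⇒T (s ∷ w) = S⇒T s ∷ mapʷ f S⇒T w

  Path⇒Linked : ∀ {T : Rel A 0ℓ} → S ⇒ T → ∀ {a xs b z} → Path S a xs b → T b z →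
                Linked T (a ∷ xs ++ z ∷ [])
  Path⇒Linked S⇒T []      t = t ∷ [-]
  Path⇒Linked S⇒T (s ∷ p) t = S⇒T s ∷ Path⇒Linked S⇒T p t

  suffix : ∀ {a c xs b} → a ∈ c ∷ xs → Path S c xs b → Unique (c ∷ xs) →
           ∃[ ys ] Path S a ys b × Unique (a ∷ ys) × length ys ≤ length xs
  suffix (here refl) p       u       = _ , p , u , ≤-refl
  suffix (there a∈)  (_ ∷ p) (_ ∷ u) with suffix a∈ p u
  ... | ys , q , v , l = ys , q , v , m≤n⇒m≤1+n l

  prefix : ∀ {a xs b} → Path S a xs b → (i : Fin (length xs)) →
           Path S a (take (suc (toℕ i)) xs) (lookup xs i)
  prefix (s ∷ p) zero    = s ∷ []
  prefix (s ∷ p) (suc i) = s ∷ prefix p i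

  module _ (_≟_ : DecidableEquality A) where

    -- The loop at the new first vertex is cut: if that vertex already occurs on the simple path
    -- obtained for the rest, the path is restarted from that occurrence.
    eraseLoops : ∀ {n a b} → Walk S n a b →
                 ∃[ xs ] Path S a xs b × Unique (a ∷ xs) × length xs ≤ n
    eraseLoops []              = [] , [] , [] ∷ [] , z≤n
    eraseLoops {a = a} (_∷_ {b = b} s w) with eraseLoops w
    ... | xs , p , u , l with member? _≟_ a (b ∷ xs)
    ...   | no a∉ = b ∷ xs , s ∷ p , ¬Any⇒All¬ _ a∉ ∷ u , s≤s l
    ...   | yes a∈ with suffix a∈ p u
    ...     | ys , q , v , l′ = ys , q , v , ≤-trans l′ (m≤n⇒m≤1+n l)

lookup-injective : ∀ {A : Set} {xs : List A} → Unique xs → Injective _≡_ _≡_ (lookup xs)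
lookup-injective (x∉ ∷ u) {zero}  {zero}  eq = refl
lookup-injective (x∉ ∷ u) {zero}  {suc j} eq = contradiction eq (All.lookup x∉ (∈-lookup j))
lookup-injective (x∉ ∷ u) {suc i} {zero}  eq = contradiction (sym eq) (All.lookup x∉ (∈-lookup i))
lookup-injective (x∉ ∷ u) {suc i} {suc j} eq = cong suc (lookup-injective u eq)

-- Vertex sequences without backtracking: entries two places apart differ. Adjacency of consecutive
-- entries is left to `Path`.
data Reduced {A : Set} : List A → Set where
  single : ∀ {x} → Reduced (x ∷ [])
  double : ∀ {x y} → Reduced (x ∷ y ∷ [])
  _∷_    : ∀ {x y z xs} → x ≢ z → Reduced (y ∷ z ∷ xs) → Reduced (x ∷ y ∷ z ∷ xs)

-- Counting neighbours, and cycles forced by short walks.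

module _ (G : Graph) where
  open Graph G renaming (sym to ~-sym)

  injection⇒≤# : ∀ {P : Pred V 0ℓ} (P? : U.Decidable P) {n} (g : Fin n → V) →
                 (∀ i → P (g i)) → Injective _≡_ _≡_ g → n ≤ # P?
  injection⇒≤# P? g Pg g-inj = Fin.injective⇒≤ λ {i} {j} eq →
    g-inj (Membership.index-injective (setoid V)
             (∈-filter⁺ P? (∈-allFin (g i)) (Pg i)) (∈-filter⁺ P? (∈-allFin (g j)) (Pg j)) eq)

  module _ (a : V) where

    private
      nbrs : List V
      nbrs = filter (a ~?_) (allFin order)

      lookup-~ : ∀ i → a ~ lookup nbrs i
      lookup-~ i = proj₂ (∈-filter⁻ (a ~?_) {xs = allFin order} (∈-lookup i))

      nbrs-unique : Unique nbrs
      nbrs-unique = filter⁺ (a ~?_) (allFin⁺ order)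

    numberNeighbours : ∀ {n} → n ≤ deg a →
      Σ[ e ∈ (Fin n → V) ] (∀ i → a ~ e i) × Injective _≡_ _≡_ e
    numberNeighbours n≤d =
      (λ i → lookup nbrs (inject≤ i n≤d)) , (λ _ → lookup-~ _) ,
      λ eq → Fin.inject≤-injective n≤d n≤d _ _ (lookup-injective nbrs-unique eq)

    -- A transposition of positions in the neighbour list moves `u` to the prescribed place `j`. The
    -- embedding of `R k` uses this to fix the port that leads back to the parent.
    numberNeighboursWith : ∀ {n} → n ≤ deg a → (j : Fin n) → ∀ {u} → a ~ u →
      Σ[ e ∈ (Fin n → V) ] (∀ i → a ~ e i) × Injective _≡_ _≡_ e × e j ≡ u
    numberNeighboursWith {n} n≤d j {u} a~u =
      (λ i → lookup nbrs (exchange (inj i))) , (λ _ → lookup-~ _) ,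
      (λ eq → Fin.inject≤-injective n≤d n≤d _ _
                (exchange-injective (lookup-injective nbrs-unique eq))) ,
      trans (cong (lookup nbrs) exchange-j) (sym (lookup-index u∈))
      where
      u∈ : u ∈ nbrs
      u∈ = ∈-filter⁺ (a ~?_) (∈-allFin u) a~u

      inj : Fin n → Fin (length nbrs)
      inj i = inject≤ i n≤d

      exchange : Fin (length nbrs) → Fin (length nbrs)
      exchange = transpose (inj j) (index u∈)

      exchange-injective : Injective _≡_ _≡_ exchange
      exchange-injective {x} {y} eq =
        trans (sym (transpose-inverse _ _))
              (trans (cong (transpose (index u∈) (inj j)) eq) (transpose-inverse _ _))

      exchange-j : exchange (inj j) ≡ index u∈
      exchange-j rewrite dec-true (inj j Fin.≟ inj j) refl = refl

  module _ {N : ℕ} (N≤cycles : ∀ {ℓ} → CycleOfLength G ℓ → N ≤ ℓ) where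

    -- The walk followed by the edge from b to a closes up to a cycle.
    bypass : ∀ {S : Rel V 0ℓ} → S ⇒ _~_ → ∀ {n a b} → Walk S n a b →
             a ~ b → ¬ S a b → N ≤ suc n
    bypass S⇒~ w a~b ¬Sab with eraseLoops Fin._≟_ w
    ... | [] , [] , _ , _ = contradiction a~b (irrefl refl)
    -- A simple path with one edge would be the step from `a` to `b`, which `S` lacks; so a
    -- remaining path has at least three vertices, as a cycle requires.
    ... | _ ∷ [] , s ∷ [] , _ , _ = contradiction s ¬Sab
    ... | xs@(_ ∷ _ ∷ _) , p , u , l = ≤-trans (N≤cycles cycle) (s≤s l)
      where
      cycle : CycleOfLength G (suc (length xs))
      cycle = record
        { start = _ ; rest = xs ; distinct = u
        ; closed = Path⇒Linked S⇒~ p (~-sym a~b)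
        ; length≡ = refl ; 3≤length = s≤s (s≤s (s≤s z≤n)) }

    private
      noReturn : ∀ {a c xs b} → a ~ c → Path _~_ c xs b → Reduced (a ∷ c ∷ xs) →
                 Unique (c ∷ xs) → suc (length xs) < N → ¬ (a ∈ xs)
      noReturn _ _ (a≢d ∷ _) _ _ (here refl) = a≢d refl
      noReturn {xs = xs@(_ ∷ _ ∷ _)} a~c p _ u l (there a∈) =
        <⇒≱ l (≤-trans (N≤cycles cycle)
                       (s≤s (≤-trans (≤-reflexive (length-take n xs)) (m⊓n≤n n (length xs)))))
        where
        n : ℕ
        -- `a∈` points into the tail of `xs`: one is added for the head of `xs` and one to include
        -- `a` itself. The path from `c` up to `a` closes by the edge from `a` to `c`.
        n = 2 + toℕ (index a∈)

        cycle : CycleOfLength G (suc (length (take n xs)))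
        cycle = record
          { start = _ ; rest = take n xs ; distinct = take⁺ (suc n) u
          ; closed = Path⇒Linked id (prefix p (suc (index a∈)))
                       (subst (_~ _) (lookup-index a∈) a~c)
          ; length≡ = refl ; 3≤length = s≤s (s≤s (s≤s z≤n)) }

      tailReduced : ∀ {x y ys} → Reduced {V} (x ∷ y ∷ ys) → Reduced (y ∷ ys)
      tailReduced double  = single
      tailReduced (_ ∷ r) = r

    -- By induction the tail is already a simple path, so only a recurrence of the first vertex
    -- remains to be excluded; it would close a cycle of length less than `N`.
    reduced⇒unique : ∀ {a xs b} → Path _~_ a xs b → Reduced (a ∷ xs) → length xs < N →
                     Unique (a ∷ xs)
    reduced⇒unique []      r l = [] ∷ []
    reduced⇒unique {a} {c ∷ xs} (s ∷ p) r l = ¬Any⇒All¬ _ a∉ ∷ u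
      where
      u : Unique (c ∷ xs)
      u = reduced⇒unique p (tailReduced r) (<-trans (n<1+n _) l)

      a∉ : ¬ (a ∈ c ∷ xs)
      a∉ (here refl) = irrefl refl s
      a∉ (there a∈)  = noReturn s p r u l a∈

-- Distances in R k

module _ {k : ℕ} where

  colour : RVertex k → ℕ
  colour root          = k
  colour (child _ j _) = j

  HasChild? : ∀ (v : RVertex k) j → Dec (HasChild v j)
  HasChild? root j = 1 ≤? j ×-dec j <? k
  HasChild? (child root i _) j = 1 ≤? j ×-dec j <? k ×-dec ¬? (j ≟ i)
  HasChild? (child (child root i _) j _) l = 1 ≤? l ×-dec l <? j ×-dec ¬? (l ≟ i)
  HasChild? (child (child (child _ _ _) _ _) j _) l = 1 ≤? l ×-dec l <? j

  hasChild : ∀ (v : RVertex k) {j} → .(HasChild v j) → HasChild v j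
  hasChild v {j} p = recompute (HasChild? v j) p

  child-colour : ∀ (v : RVertex k) {j} → .(HasChild v j) → (1 ≤ j × j < k) × j ≢ colour v
  child-colour v p = go v (hasChild v p)
    where
    go : ∀ (v : RVertex k) {j} → HasChild v j → (1 ≤ j × j < k) × j ≢ colour v
    go root                              (1≤ , <k)       = (1≤ , <k) , <⇒≢ <k
    go (child root _ _)                  (1≤ , <k , ≢i)  = (1≤ , <k) , ≢i
    go (child v@(child root _ _) _ p)    (1≤ , <j , _)   =
      (1≤ , <-trans <j (proj₂ (proj₁ (go v (hasChild v p))))) , <⇒≢ <j
    go (child v@(child (child _ _ _) _ _) _ p) (1≤ , <j) =
      (1≤ , <-trans <j (proj₂ (proj₁ (go v (hasChild v p))))) , <⇒≢ <j

  1≤j<k : ∀ (v : RVertex k) {j} → .(HasChild v j) → 1 ≤ j × j < k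
  1≤j<k v p = proj₁ (child-colour v p)

  descending : ∀ (u : RVertex k) {i} .{p} {j} .{q} {l} →
               HasChild (child (child u i p) j q) l → l < j
  descending root          (_ , l<j , _) = l<j
  descending (child _ _ _) (_ , l<j)     = l<j

  infix 4 _≟ᴿ_
  _≟ᴿ_ : DecidableEquality (RVertex k)
  root        ≟ᴿ root          = yes refl
  root        ≟ᴿ child _ _ _   = no λ ()
  child _ _ _ ≟ᴿ root          = no λ ()
  child v i _ ≟ᴿ child w j _ with v ≟ᴿ w | i ≟ j
  ... | yes refl | yes refl = yes refl
  ... | no v≢w   | _        = no λ { refl → v≢w refl }
  ... | yes _    | no i≢j   = no λ { refl → i≢j refl }

  depth : RVertex k → ℕ
  depth root          = 0
  depth (child v _ _) = suc (depth v)

  infix 4 _~ᴿ_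
  _~ᴿ_ : Rel (RVertex k) 0ℓ
  _~ᴿ_ = SimpleGraph._~_ (R k)

  -- `below` refers to the ancestor of `v` at depth 2, of colour `j`. From there on colours strictly
  -- decrease, so `n` steps further down at most `j - n` is left; as colours are at least 1, this
  -- gives `n < j`.
  data Position : RVertex k → Set where
    at-root : Position root
    at-top  : ∀ {i} .{p} → Position (child root i p)
    below   : ∀ {i} .{p} {j} .{q} {n v} → Walk _~ᴿ_ n v (child (child root i p) j q) →
              n + colour v ≤ j → n < j → depth v ≤ 2 + n → Position v

  position : ∀ v → Position v
  position root                        = at-root
  position (child root _ _)            = at-top
  position (child v@(child root _ _) _ p) =
    below [] ≤-refl (proj₁ (1≤j<k v p)) ≤-refl
  position (child v@(child (child u _ _) _ _) j p) with position v
  ... | below {n = n} w n+c≤j′ n<j′ d≤ =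
    below (inj₁ childOf ∷ w) sn+j≤j′
          (≤-trans (s≤s (≤-trans (≤-reflexive (+-comm 1 n)) (+-monoʳ-≤ n (proj₁ (1≤j<k v p)))))
                   sn+j≤j′)
          (s≤s d≤)
    where
    sn+j≤j′ : suc n + j ≤ _
    sn+j≤j′ = ≤-trans (≤-reflexive (sym (+-suc n j)))
                      (≤-trans (+-monoʳ-≤ n (descending u (hasChild v p))) n+c≤j′)

  -- Below depth 2 there are `n + 2` steps, and `n < j < k` makes this at most `k`. Joining two such
  -- walks at the root bounds all distances by `2k`.
  toRoot : 2 ≤ k → ∀ {v} → Position v → Walk _~ᴿ_ k v root
  toRoot 2≤k at-root = []
  toRoot 2≤k at-top  = weaken (≤-trans (s≤s z≤n) 2≤k) (inj₁ childOf ∷ [])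
  toRoot 2≤k (below {i} {p} {j} {q} {n} w _ n<j _) =
    weaken (≤-trans (≤-reflexive (+-comm n 2))
                    (≤-trans (s≤s n<j) (proj₂ (1≤j<k (child root i p) q))))
           (w ++ʷ inj₁ childOf ∷ inj₁ childOf ∷ [])

  depth≤ : 2 ≤ k → ∀ v → depth v ≤ k
  depth≤ 2≤k v with position v
  ... | at-root = z≤n
  ... | at-top  = ≤-trans (s≤s z≤n) 2≤k
  ... | below {i} {p} {j} {q} _ _ n<j d≤ =
    ≤-trans d≤ (≤-trans (s≤s n<j) (proj₂ (1≤j<k (child root i p) q)))

  -- A vertex at depth `n + 1` satisfying `P` is a vertex at depth `n` with a child satisfying `P`,
  -- so the search for the child, among finitely many colours, is moved into the predicate.
  anyAtDepth? : ∀ n {P : Pred (RVertex k) 0ℓ} → U.Decidable P → Dec (∃[ v ] depth v ≡ n × P v)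
  anyAtDepth? zero    P? = map′
    (λ Proot → root , refl , Proot) (λ { (root , _ , Proot) → Proot }) (P? root)
  anyAtDepth? (suc n) {P} P? = map′
    (λ { (v , d , j , p , Pc) → child v (toℕ j) p , cong suc d , Pc })
    (λ { (child v j p , d , Pc) → v , suc-injective d , to v p Pc })
    (anyAtDepth? n λ v → Fin.any? λ j → dec v (toℕ j))
    where
    dec : ∀ v j → Dec (Σ[ p ∈ HasChild v j ] P (child v j p))
    dec v j with HasChild? v j
    ... | no ¬p = no (¬p ∘ proj₁)
    ... | yes p = map′ (p ,_) proj₂ (P? (child v j p))

    to : ∀ v {j} .(p : HasChild v j) → P (child v j p) →
         ∃[ i ] Σ[ q ∈ HasChild v (toℕ {k} i) ] P (child v (toℕ i) q)
    to v {j} p Pc with Fin.fromℕ< (proj₂ (1≤j<k v p)) | Fin.toℕ-fromℕ< (proj₂ (1≤j<k v p))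
    ... | i | refl = i , hasChild v p , Pc

  -- Unfolding this search during with-abstraction would be very slow.
  abstract
    anyVertex? : 2 ≤ k → {P : Pred (RVertex k) 0ℓ} → U.Decidable P → Dec (∃ P)
    anyVertex? 2≤k P? = map′
      (λ (_ , v , _ , Pv) → v , Pv)
      (λ (v , Pv) → Fin.fromℕ< (s≤s (depth≤ 2≤k v)) , v , sym (Fin.toℕ-fromℕ< _) , Pv)
      (Fin.any? {suc k} λ n → anyAtDepth? (toℕ n) P?)

-- The colour j is represented by the index j - 1.
slot : ∀ {K} j → .(1 ≤ j × j < suc K) → Fin K
slot zero    p = ⊥-elim-irr (1+n≰n (proj₁ p))
slot (suc j) p = fromℕ< (s≤s⁻¹ (proj₂ p))

suc-toℕ-slot : ∀ {K} j .(p : 1 ≤ j × j < suc K) → suc (toℕ (slot {K} j p)) ≡ j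
suc-toℕ-slot zero    p = ⊥-elim-irr (1+n≰n (proj₁ p))
suc-toℕ-slot (suc j) p = cong suc (Fin.toℕ-fromℕ< (s≤s⁻¹ (proj₂ p)))

slot-injective : ∀ {K} i j .(p : 1 ≤ i × i < suc K) .(q : 1 ≤ j × j < suc K) →
                 slot {K} i p ≡ slot j q → i ≡ j
slot-injective i j p q eq =
  trans (sym (suc-toℕ-slot i p)) (trans (cong (suc ∘ toℕ) eq) (suc-toℕ-slot j q))

module _ {L : ℕ} where

  private
    K : ℕ
    K = 2 + L

    k : ℕ
    k = suc K

  -- The root is put arbitrarily into the branch of the child of colour 1, which keeps the number of
  -- branches at `K`; it is close enough to every vertex for `sameBranch⇒near`.
  branch : ∀ {v : RVertex k} → Position v → Fin K
  branch at-root               = zero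
  branch (at-top {i} {p})      = slot i (1≤j<k root p)
  branch (below {i} {p} _ _ _ _) = slot i (1≤j<k root p)

  -- The bound is `2k - 3`. Two vertices under the same child of the root are joined through it in
  -- `(n + 1) + (n′ + 1)` steps, where `n < j` and `n′ < j′`. If `j` and `j′` differ, one of them is
  -- at most `K - 1`; if they agree, the walks already meet at depth 2.
  sameBranch⇒near : ∀ {v w : RVertex k} (x : Position v) (y : Position w) →
                    branch x ≡ branch y → Walk _~ᴿ_ (suc L + K) v w
  sameBranch⇒near x at-root _ = weaken (s≤s (m≤n+m K L)) (toRoot (s≤s (s≤s z≤n)) x)
  sameBranch⇒near at-root y _ =
    reverseʷ swap (weaken (s≤s (m≤n+m K L)) (toRoot (s≤s (s≤s z≤n)) y))
  sameBranch⇒near (at-top {i} {p}) (at-top {i′} {p′}) eq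
    with refl ← slot-injective i i′ (1≤j<k root p) (1≤j<k root p′) eq = []
  sameBranch⇒near (at-top {i} {p}) (below {i′} {p′} {j} {q} {n} w _ n<j _) eq
    with refl ← slot-injective i i′ (1≤j<k root p) (1≤j<k root p′) eq =
    reverseʷ swap (topNear {p = p} {q = q} w n<j)
    where
    topNear : ∀ {i} .{p} {j} .{q} {n v} → Walk _~ᴿ_ n v (child (child root i p) j q) → n < j →
              Walk _~ᴿ_ (suc L + K) v (child root i p)
    topNear {i} {p} {j} {q} {n} w n<j =
      weaken (≤-trans (≤-reflexive (+-comm n 1))
                      (≤-trans n<j (≤-trans (s≤s⁻¹ (proj₂ (1≤j<k (child root i p) q)))
                                             (m≤n+m K (suc L)))))
             (w ++ʷ inj₁ childOf ∷ [])
  sameBranch⇒near x@(below _ _ _ _) y@at-top eq = reverseʷ swap (sameBranch⇒near y x (sym eq))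
  sameBranch⇒near (below {i} {p} {j} {q} {n} w _ n<j _)
                  (below {i′} {p′} {j′} {q′} {n′} w′ _ n′<j′ _) eq
    with refl ← slot-injective i i′ (1≤j<k root p) (1≤j<k root p′) eq = go (<-cmp j j′)
    where
    j≤K : j ≤ K
    j≤K = s≤s⁻¹ (proj₂ (1≤j<k (child root i p) q))

    j′≤K : j′ ≤ K
    j′≤K = s≤s⁻¹ (proj₂ (1≤j<k (child root i p) q′))

    over : Walk _~ᴿ_ (suc n + suc n′) _ _
    over = weaken (≤-reflexive (+-suc n (suc n′)))
             (w ++ʷ inj₁ childOf ∷ inj₂ childOf ∷ reverseʷ swap w′)

    go : _ → Walk _~ᴿ_ (suc L + K) _ _
    go (tri≈ _ refl _) =
      weaken (+-mono-≤ (s≤s⁻¹ (≤-trans n<j j≤K)) (≤-trans (n≤1+n n′) (≤-trans n′<j′ j′≤K)))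
             (w ++ʷ reverseʷ swap w′)
    go (tri< j<j′ _ _) =
      weaken (+-mono-≤ (≤-trans n<j (s≤s⁻¹ (≤-trans j<j′ j′≤K))) (≤-trans n′<j′ j′≤K)) over
    go (tri> _ _ j′<j) =
      weaken (≤-trans (+-mono-≤ (≤-trans n<j j≤K) (≤-trans n′<j′ (s≤s⁻¹ (≤-trans j′<j j≤K))))
                      (≤-reflexive (+-comm K (suc L)))) over

-- Greedy colouring

module _ (G : Graph) {k : ℕ} where
  open Graph G renaming (sym to ~-sym)

  -- A partial colouring with domain `D`: values of `c` outside `D` carry no meaning. The witnesses
  -- in `grundy` lie in `D`, so they survive when `D` grows.
  record GrundyOn (D : Pred V 0ℓ) (c : V → Fin k) : Set where
    field
      proper : ∀ {x y} → D x → D y → x ~ y → c x ≢ c y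
      grundy : ∀ {x i} → D x → i Fin.< c x → ∃[ w ] D w × x ~ w × c w ≡ i

  open GrundyOn

  private
    resp : ∀ {D E : Pred V 0ℓ} {c} → (∀ {x} → D x → E x) → (∀ {x} → E x → D x) →
           GrundyOn D c → GrundyOn E c
    resp D⊆E E⊆D g .proper Ex Ey = g .proper (E⊆D Ex) (E⊆D Ey)
    resp D⊆E E⊆D g .grundy Ex i<c with g .grundy (E⊆D Ex) i<c
    ... | w , Dw , rest = w , D⊆E Dw , rest

  -- `x` receives the least colour absent from its neighbours in `D`. If all colours were present,
  -- one neighbour of each would contradict the last hypothesis; minimality gives the Grundy
  -- condition at `x`.
  colourVertex : ∀ {D : Pred V 0ℓ} (D? : U.Decidable D) {c} → GrundyOn D c → ∀ {x} → ¬ D x →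
    (∀ (g : Fin k → V) → (∀ i → x ~ g i × D (g i)) → ¬ Injective _≡_ _≡_ g) →
    ∃[ c′ ] GrundyOn (λ y → D y ⊎ y ≡ x) c′ × (∀ {y} → D y → c′ y ≡ c y)
  colourVertex {D} D? {c} good {x} ¬Dx few = c′ , good′ , old
    where
    Used : Pred (Fin k) 0ℓ
    Used i = ∃[ y ] (x ~ y × D y) × c y ≡ i

    free : ∃[ i ] ¬ Used i × ((j : Fin.Fin′ i) → Used (inject j))
    free = Fin.¬∀⟶∃¬-smallest k Used
      (λ i → Fin.any? λ y → (x ~? y ×-dec D? y) ×-dec c y Fin.≟ i)
      λ used → few (proj₁ ∘ used) (proj₁ ∘ proj₂ ∘ used) λ {i} {j} eq →
        trans (sym (proj₂ (proj₂ (used i)))) (trans (cong c eq) (proj₂ (proj₂ (used j))))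

    new : Fin k
    new = proj₁ free

    c′ : V → Fin k
    c′ = updateAt c x (const new)

    c′x : c′ x ≡ new
    c′x = updateAt-updates x c

    old : ∀ {y} → D y → c′ y ≡ c y
    old {y} Dy = updateAt-minimal y x c λ { refl → ¬Dx Dy }

    unused : ∀ {y} → D y → x ~ y → c′ x ≢ c′ y
    unused Dy x~y eq = proj₁ (proj₂ free)
      (_ , (x~y , Dy) , trans (sym (old Dy)) (trans (sym eq) c′x))

    good′ : GrundyOn (λ y → D y ⊎ y ≡ x) c′
    good′ .proper (inj₁ Dy)   (inj₁ Dz)   y~z eq =
      good .proper Dy Dz y~z (trans (sym (old Dy)) (trans eq (old Dz)))
    good′ .proper (inj₁ Dy)   (inj₂ refl) y~x eq = unused Dy (~-sym y~x) (sym eq)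
    good′ .proper (inj₂ refl) (inj₁ Dy)   x~y    = unused Dy x~y
    good′ .proper (inj₂ refl) (inj₂ refl) x~x    = contradiction x~x (irrefl refl)
    good′ .grundy {i = i} (inj₁ Dy) i< with good .grundy Dy (subst (i Fin.<_) (old Dy) i<)
    ... | w , Dw , y~w , cw = w , inj₁ Dw , y~w , trans (old Dw) cw
    good′ .grundy {i = i} (inj₂ refl) i<
      with proj₂ (proj₂ free) (fromℕ< i<new)
         | Fin.toℕ-injective (trans (Fin.toℕ-inject (fromℕ< i<new)) (Fin.toℕ-fromℕ< i<new))
      where
      i<new : i Fin.< new
      i<new = subst (i Fin.<_) c′x i<
    ... | w , (x~w , Dw) , cw | eq = w , inj₁ Dw , x~w , trans (old Dw) (trans cw eq)

  module _ {B : Pred V 0ℓ} (B? : U.Decidable B) (μ : V → ℕ) (μ-injective : Injective _≡_ _≡_ μ)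
    (few : ∀ {x} → ¬ B x → ∀ (g : Fin k → V) →
           (∀ i → x ~ g i × (B (g i) ⊎ μ (g i) < μ x)) → ¬ Injective _≡_ _≡_ g)
    {c₀ : V → Fin k} (good₀ : GrundyOn B c₀) where

    private
      D : ℕ → Pred V 0ℓ
      D n x = B x ⊎ μ x < n

      D-suc : ∀ n {x} → D (suc n) x → D n x ⊎ μ x ≡ n
      D-suc n (inj₁ Bx) = inj₁ (inj₁ Bx)
      D-suc n (inj₂ μ<) with m≤n⇒m<n∨m≡n (s≤s⁻¹ μ<)
      ... | inj₁ μ<n = inj₁ (inj₂ μ<n)
      ... | inj₂ μ≡n = inj₂ μ≡n

    -- Vertices outside `B` are coloured in increasing order of `μ`. Injectivity of `μ` leaves at
    -- most one of them per step, and `few` says that a colour is free for it.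
    greedyExtension : ∀ n → ∃[ c ] GrundyOn (λ x → B x ⊎ μ x < n) c × (∀ {x} → B x → c x ≡ c₀ x)
    greedyExtension zero =
      c₀ , resp inj₁ (λ { (inj₁ Bx) → Bx }) good₀ , λ _ → refl
    greedyExtension (suc n) with greedyExtension n | Fin.any? (λ x → ¬? (B? x) ×-dec μ x ≟ n)
    ... | c , good , agree | no none =
      c , resp (Sum.map₂ m<n⇒m<1+n) shrink good , agree
      where
      shrink : ∀ {x} → D (suc n) x → D n x
      shrink {x} Dx with D-suc n Dx
      ... | inj₁ Dx′ = Dx′
      ... | inj₂ μ≡n with B? x
      ...   | yes Bx = inj₁ Bx
      ...   | no ¬Bx = contradiction (x , ¬Bx , μ≡n) none
    ... | c , good , agree | yes (x , ¬Bx , refl)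
      with colourVertex (λ y → B? y ⊎-dec μ y <? n) good
             (λ { (inj₁ Bx) → ¬Bx Bx ; (inj₂ n<n) → <-irrefl refl n<n }) (few ¬Bx)
    ...   | c′ , good′ , old =
      c′ , resp grow (Sum.map₂ μ-injective ∘ D-suc n) good′ ,
      λ Bx → trans (old (inj₁ Bx)) (agree Bx)
      where
      grow : ∀ {y} → D n y ⊎ y ≡ x → D (suc n) y
      grow (inj₁ Dy)   = Sum.map₂ m<n⇒m<1+n Dy
      grow (inj₂ refl) = inj₂ ≤-refl

-- The upper bound on the number of colours of a z-colouring.

module _ (G : Graph) where
  open Graph G renaming (sym to ~-sym)

  -- `punchIn (c v)` enumerates the `m` colours other than that of `v`, and neighbours of different
  -- colours are different.
  bVertex⇒≤deg : ∀ {m} (c : V → Fin (suc m)) {v} → BVertex G c v → m ≤ deg v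
  bVertex⇒≤deg c {v} b = injection⇒≤# G (v ~?_) (λ i → proj₁ (w i)) (λ i → proj₁ (proj₂ (w i)))
    λ {i} {j} eq → Fin.punchIn-injective (c v) i j
      (trans (sym (proj₂ (proj₂ (w i)))) (trans (cong c eq) (proj₂ (proj₂ (w j)))))
    where
    w : ∀ i → ∃[ w ] v ~ w × c w ≡ punchIn (c v) i
    w i = b (punchIn (c v) i) (Fin.punchInᵢ≢i (c v) i)

  zColoring⇒≤ : ∀ {m n} → m*[ G ]≡ m → (c : V → Fin n) → ZColoring G c → n ≤ suc m
  zColoring⇒≤ {n = zero}  _         _ _ = z≤n
  zColoring⇒≤ {n = suc n} (_ , max) c (_ , u , _ , nice) = s≤s (max (u ,
      bVertex⇒≤deg c (λ j j≢ → let w , u~w , cw , _ = nice j j≢ in w , u~w , cw) ,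
      injection⇒≤# G (λ w → u ~? w ×-dec n ≤? deg w) (λ i → proj₁ (w i))
        (λ i → let _ , u~w , _ , b = w i in u~w , bVertex⇒≤deg c b)
        λ {i} {j} eq → Fin.punchIn-injective (c u) i j
          (trans (sym (proj₁ (proj₂ (proj₂ (w i)))))
                 (trans (cong c eq) (proj₁ (proj₂ (proj₂ (w j))))))))
    where
    w : ∀ i → ∃[ w ] u ~ w × c w ≡ punchIn (c u) i × BVertex G c w
    w i = nice (punchIn (c u) i) (Fin.punchInᵢ≢i (c u) i)

-- The canonical colouring of R k

module _ {L : ℕ} where

  private
    K : ℕ
    K = 2 + L

    k : ℕ
    k = suc K

  canonical : RVertex k → Fin k
  canonical root          = fromℕ K
  canonical (child v j p) = inject₁ (slot j (1≤j<k v p))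

  suc-toℕ-canonical : ∀ v → suc (toℕ (canonical v)) ≡ colour v
  suc-toℕ-canonical root          = cong suc (Fin.toℕ-fromℕ K)
  suc-toℕ-canonical (child v j p) =
    trans (cong suc (Fin.toℕ-inject₁ _)) (suc-toℕ-slot j (1≤j<k v p))

  canonical≡ : ∀ {v i} → colour v ≡ suc (toℕ i) → canonical v ≡ i
  canonical≡ {v} eq = Fin.toℕ-injective (suc-injective (trans (suc-toℕ-canonical v) eq))

  canonical-proper : ∀ {v w : RVertex k} → v ~ᴿ w → canonical v ≢ canonical w
  canonical-proper {v} {w} v~w eq = go v~w
    (trans (sym (suc-toℕ-canonical v)) (trans (cong (suc ∘ toℕ) eq) (suc-toℕ-canonical w)))
    where
    go : ∀ {v w : RVertex k} → v ~ᴿ w → colour v ≢ colour w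
    go {v = child u j p} (inj₁ childOf) = proj₂ (child-colour u p)
    go {w = child u j p} (inj₂ childOf) = ≢-sym (proj₂ (child-colour u p))

  canonical-bVertex : ∀ {i} .{p : 1 ≤ i × i < k} (j : Fin k) → suc (toℕ j) ≢ i →
                      ∃[ w ] child root i p ~ᴿ w × canonical w ≡ j
  canonical-bVertex {i} {p} j j≢i with m≤n⇒m<n∨m≡n (Fin.toℕ<n j)
  ... | inj₁ j<k = let w = child (child root i p) (suc (toℕ j)) (s≤s z≤n , j<k , j≢i) in
                   w , inj₂ childOf , canonical≡ {w} refl
  ... | inj₂ j≡k = root , inj₁ childOf , canonical≡ {root} (sym j≡k)

  canonical-grundy : ∀ (v : RVertex k) {i} → i Fin.< canonical v →
                     ∃[ w ] v ~ᴿ w × canonical w ≡ i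
  canonical-grundy v {i} i<c = go v (subst (suc (toℕ i) <_) (suc-toℕ-canonical v) (s≤s i<c))
    where
    toChild : ∀ v → HasChild v (suc (toℕ i)) → ∃[ w ] v ~ᴿ w × canonical w ≡ i
    toChild v p = child v (suc (toℕ i)) p , inj₂ childOf , canonical≡ {child v _ p} refl

    go : ∀ v → suc (toℕ i) < colour v → ∃[ w ] v ~ᴿ w × canonical w ≡ i
    go root i< = toChild root (s≤s z≤n , i<)
    go v@(child root j p) i< =
      toChild v (s≤s z≤n , <-trans i< (proj₂ (1≤j<k root p)) , <⇒≢ i<)
    -- A vertex at depth 2 has no child of its parent's colour `l`; the parent itself supplies that
    -- colour.
    go v@(child (child root l p) j q) i< with suc (toℕ i) ≟ l
    ... | yes eq   = child root l p , inj₁ childOf , canonical≡ {child root l p} (sym eq)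
    ... | no i≢l   = toChild v (s≤s z≤n , i< , i≢l)
    go v@(child (child (child _ _ _) _ _) j q) i< = toChild v (s≤s z≤n , i<)

  -- Extension of the canonical colouring from a copy of `R k` to `G`.

  module _ (G : Graph) (m*≡K : m*[ G ]≡ K) (≤cycles : ∀ {ℓ} → CycleOfLength G ℓ → 2 * k + 2 ≤ ℓ)
           (R⊑G : R k ⊑ Graph.simpleGraph G) where
    open Graph G renaming (sym to ~-sym)

    private
      f : RVertex k → V
      f = proj₁ R⊑G

      f-injective : Injective _≡_ _≡_ f
      f-injective = proj₁ (proj₂ R⊑G)

      f-~ : ∀ {v w} → v ~ᴿ w → f v ~ f w
      f-~ = proj₂ (proj₂ R⊑G)

      InR Near : Pred V 0ℓ
      InR x = ∃[ v ] f v ≡ x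
      Near x = ∃[ v ] (x ≡ f v ⊎ x ~ f v)

      2≤k : 2 ≤ k
      2≤k = s≤s (s≤s z≤n)

      InR? : U.Decidable InR
      InR? x = anyVertex? 2≤k (λ v → f v Fin.≟ x)

      Near? : U.Decidable Near
      Near? x = anyVertex? 2≤k (λ v → x Fin.≟ f v ⊎-dec x ~? f v)

      -- An edge of `G` between equally coloured vertices of the copy is not the image of a tree
      -- edge. With the walk through the root, of length at most `2k` and using only tree edges, it
      -- would give a cycle of length at most `2k + 1`.
      induced : ∀ {v w} → f v ~ f w → canonical v ≢ canonical w
      induced {v} {w} fv~fw eq = <⇒≱ short
        (bypass G ≤cycles (λ { (_ , _ , x~y , refl , refl) → f-~ x~y })
          (mapʷ {T = Image} f (λ x~y → _ , _ , x~y , refl , refl)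
            (toRoot 2≤k (position v) ++ʷ reverseʷ swap (toRoot 2≤k (position w))))
          fv~fw
          λ (_ , _ , x~y , eq₁ , eq₂) → canonical-proper x~y
            (trans (cong canonical (f-injective eq₁))
                   (trans eq (cong canonical (sym (f-injective eq₂))))))
        where
        Image : Rel V 0ℓ
        Image a b = ∃[ x ] ∃[ y ] x ~ᴿ y × f x ≡ a × f y ≡ b

        short : suc (k + k) < 2 * k + 2
        short = ≤-reflexive (solve 1 (λ x → con 2 :+ (x :+ x) := con 2 :* x :+ con 2) refl k)
          where open +-*-Solver

      c₀ : V → Fin k
      c₀ x with InR? x
      ... | yes (v , _) = canonical v
      -- A dummy value, since the domain of the initial colouring is `InR`.
      ... | no _        = zero

      c₀-f : ∀ v → c₀ (f v) ≡ canonical v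
      c₀-f v with InR? (f v)
      ... | yes (w , eq) = cong canonical (f-injective eq)
      ... | no ∉R        = contradiction (v , refl) ∉R

      good₀ : GrundyOn G InR c₀
      good₀ .GrundyOn.proper (v , refl) (w , refl) fv~fw eq =
        induced fv~fw (trans (sym (c₀-f v)) (trans eq (c₀-f w)))
      good₀ .GrundyOn.grundy {i = i} (v , refl) i<
        with canonical-grundy v (subst (i Fin.<_) (c₀-f v) i<)
      ... | w , v~w , cw = f w , (w , refl) , f-~ v~w , trans (c₀-f w) cw

      -- Otherwise the walk from `x` through `z` into the copy, along the common branch and out to
      -- `y` has at most `1 + 1 + (2k - 3) + 1 = 2k` steps, and the edge from `y` to `x` closes a
      -- cycle that is too short.
      apart : ∀ {x} → ¬ InR x → ∀ {y z} → x ~ y → x ~ z → y ≢ z →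
              ((v , _) : Near y) ((w , _) : Near z) → branch (position v) ≢ branch (position w)
      apart {x} x∉R {y} {z} x~y x~z y≢z (v , y-v) (w , z-w) eq = <⇒≱ short
        (bypass G ≤cycles proj₁
          ((x~z , λ _ → y≢z ∘ sym) ∷ step z-w ++ʷ
           mapʷ f (λ p → f-~ p , λ fx≡ → contradiction (_ , fx≡) x∉R)
             (sameBranch⇒near (position w) (position v) (sym eq)) ++ʷ
           back y-v)
          x~y λ (_ , ok) → ok refl refl)
        where
        S : Rel V 0ℓ
        -- Only the step from `x` to `y` is removed. The walk leaves `x` towards `z`, and its later
        -- steps start at `z` or in the copy, hence not at `x`.
        S a b = a ~ b × (a ≡ x → b ≢ y)

        step : ∀ {w} → z ≡ f w ⊎ z ~ f w → Walk S 1 z (f w)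
        step (inj₁ refl) = []
        step (inj₂ z~fw) = (z~fw , λ z≡x → contradiction x~z (irrefl (sym z≡x))) ∷ []

        back : ∀ {v} → y ≡ f v ⊎ y ~ f v → Walk S 1 (f v) y
        back (inj₁ refl) = []
        back (inj₂ y~fv) = (~-sym y~fv , λ fv≡x → contradiction (_ , fv≡x) x∉R) ∷ []

        short : suc (suc (1 + (suc L + K + 1))) < 2 * k + 2
        short = ≤-reflexive (solve 1 (λ l → con 4 :+ (con 1 :+ l :+ (con 2 :+ l) :+ con 1)
                                         := con 2 :* (con 3 :+ l) :+ con 2) refl L)
          where open +-*-Solver

      rank : V → Fin 3
      rank x with k ≤? deg x | Near? x
      ... | no _  | _     = suc (suc zero)
      ... | yes _ | no _  = suc zero
      ... | yes _ | yes _ = zero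

      -- Lexicographic order by stage and then by vertex: the stages follow one another, and ties
      -- inside a stage are broken by the vertex itself.
      μ : V → ℕ
      μ x = toℕ (combine (rank x) x)

      μ-injective : Injective _≡_ _≡_ μ
      μ-injective {x} {y} eq =
        Fin.combine-injectiveʳ (rank x) x (rank y) y (Fin.toℕ-injective eq)

      rank-mono : ∀ {x y} → μ x < μ y → rank x Fin.≤ rank y
      rank-mono {x} {y} μ< = ≮⇒≥ λ r< → <-asym μ< (Fin.combine-monoˡ-< y x r<)

      rank≤0⇒Near : ∀ x → toℕ (rank x) ≤ 0 → Near x
      rank≤0⇒Near x r with k ≤? deg x | Near? x
      rank≤0⇒Near x () | no _  | _
      rank≤0⇒Near x () | yes _ | no _
      ...         | yes _ | yes near = near

      rank≤1⇒≤deg : ∀ x → toℕ (rank x) ≤ 1 → k ≤ deg x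
      rank≤1⇒≤deg x r with k ≤? deg x | Near? x
      rank≤1⇒≤deg x (s≤s ()) | no _  | _
      ...         | yes d | no _  = d
      ...         | yes d | yes _ = d

      rank≡1⇒¬Near : ∀ x → rank x ≡ suc zero → ¬ Near x
      rank≡1⇒¬Near x eq with k ≤? deg x | Near? x
      rank≡1⇒¬Near x () | no _  | _
      ...               | yes _ | no far = far
      rank≡1⇒¬Near x () | yes _ | yes _

      rank≡2⇒≰deg : ∀ x → rank x ≡ suc (suc zero) → ¬ (k ≤ deg x)
      rank≡2⇒≰deg x eq with k ≤? deg x | Near? x
      ...              | no ≰deg | _ = ≰deg
      rank≡2⇒≰deg x () | yes _   | no _
      rank≡2⇒≰deg x () | yes _   | yes _

      few : ∀ {x} → ¬ InR x → ∀ (g : Fin k → V) →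
            (∀ i → x ~ g i × (InR (g i) ⊎ μ (g i) < μ x)) → ¬ Injective _≡_ _≡_ g
      few {x} x∉R g earlier g-inj = go (rank x) refl
        where
        near : rank x ≡ zero → ∀ i → Near (g i)
        near eq i with proj₂ (earlier i)
        ... | inj₁ (v , fv≡) = v , inj₁ (sym fv≡)
        ... | inj₂ μ<        =
          rank≤0⇒Near (g i) (subst (λ r → toℕ (rank (g i)) ≤ toℕ r) eq (rank-mono μ<))

        go : ∀ r → rank x ≡ r → ⊥
        -- `k` neighbours, all in or next to the copy, fall into `K = k - 1` branches, so two share
        -- one.
        go zero eq
          with Fin.pigeonhole (n<1+n K) (λ i → branch (position (proj₁ (near eq i))))
        ... | i , j , i<j , same =
          apart x∉R (proj₁ (earlier i)) (proj₁ (earlier j)) (Fin.<⇒≢ i<j ∘ g-inj)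
                (near eq i) (near eq j) same
        -- A neighbour in the copy would make `x` near it, so all `k` neighbours were coloured in
        -- the first two stages and have degree at least `k`; then `x` would witness that `m*` is at
        -- least `k`.
        go (suc zero) eq = <⇒≱ (n<1+n K) (proj₂ m*≡K
          (x , rank≤1⇒≤deg x (≤-reflexive (cong toℕ eq)) ,
           injection⇒≤# G (λ w → x ~? w ×-dec k ≤? deg w) g
             (λ i → proj₁ (earlier i) , big i) g-inj))
          where
          big : ∀ i → k ≤ deg (g i)
          big i with earlier i
          ... | x~g , inj₁ (v , fv≡) = 
            contradiction (v , inj₂ (subst (x ~_) (sym fv≡) x~g)) (rank≡1⇒¬Near x eq)
          ... | _   , inj₂ μ<         =
            rank≤1⇒≤deg (g i) (subst (λ r → toℕ (rank (g i)) ≤ toℕ r) eq (rank-mono μ<))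
        go (suc (suc zero)) eq =
          rank≡2⇒≰deg x eq (injection⇒≤# G (x ~?_) g (proj₁ ∘ earlier) g-inj)

    R⊑⇒z≡ : z[ G ]≡ k
    -- All values of `μ` are below `3 * order`, three ranks times `order` vertices, so every vertex
    -- is coloured by then.
    R⊑⇒z≡ with greedyExtension G InR? μ μ-injective few good₀ (3 * order)
    ... | c , good , agree =
      (c , ((surjective , good .GrundyOn.proper (all _) (all _)) , grundy) , f root , top , nice) ,
      λ { (c′ , z) → zColoring⇒≤ G m*≡K c′ z }
      where
      all : ∀ x → InR x ⊎ μ x < 3 * order
      all x = inj₂ (Fin.toℕ<n (combine (rank x) x))

      c-f : ∀ v → c (f v) ≡ canonical v
      c-f v = trans (agree (v , refl)) (c₀-f v)

      cRoot : c (f root) ≡ fromℕ K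
      cRoot = c-f root

      top : suc (toℕ (c (f root))) ≡ k
      top = cong suc (trans (cong toℕ cRoot) (Fin.toℕ-fromℕ K))

      grundy : ∀ {i j} → i Fin.< j → ∀ v → c v ≡ j → ∃[ w ] v ~ w × c w ≡ i
      grundy i<j v refl with good .GrundyOn.grundy (all v) i<j
      ... | w , _ , v~w , cw = w , v~w , cw

      nice : Nice G c (f root)
      nice j j≢ = f w , f-~ (inj₂ childOf) , cw , bVertex
        where
        j<K : suc (toℕ j) < k
        j<K with m≤n⇒m<n∨m≡n (Fin.toℕ<n j)
        ... | inj₁ j<k = j<k
        ... | inj₂ j≡k = contradiction (Fin.toℕ-injective (suc-injective (trans j≡k (sym top)))) j≢

        w : RVertex k
        w = child root (suc (toℕ j)) (s≤s z≤n , j<K)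

        cw : c (f w) ≡ j
        cw = trans (c-f w) (canonical≡ {w} refl)

        bVertex : BVertex G c (f w)
        bVertex i i≢ with canonical-bVertex {suc (toℕ j)} {s≤s z≤n , j<K} i
          (λ eq → i≢ (trans (Fin.toℕ-injective (suc-injective eq)) (sym cw)))
        ... | y , w~y , cy = f y , f-~ w~y , trans (c-f y) cy

      -- The nice vertex and its neighbours already show every colour.
      surjective : ∀ j → ∃[ x ] (∀ {y} → y ≡ x → c y ≡ j)
      surjective j with j Fin.≟ c (f root)
      ... | yes j≡ = f root , λ { refl → sym j≡ }
      ... | no j≢ with nice j j≢
      ...   | w , _ , cw , _ = w , λ { refl → cw }

-- Embedding R k into graphs of large minimum degree

end∈ : ∀ {A : Set} {S : Rel A 0ℓ} {a x xs b} → Path S a (x ∷ xs) b → b ∈ x ∷ xs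
end∈ (_ ∷ [])        = here refl
end∈ (_ ∷ p@(_ ∷ _)) = there (end∈ p)

module _ {L : ℕ} where

  private
    K : ℕ
    K = 2 + L

    k : ℕ
    k = suc K

  module _ (G : Graph) (≤cycles : ∀ {ℓ} → CycleOfLength G ℓ → 2 * k + 2 ≤ ℓ)
           (K≤deg : ∀ v → K ≤ Graph.deg G v) where
    open Graph G renaming (sym to ~-sym)

    private
      -- The image of a vertex of `R k`, with `K` of its neighbours in `G` numbered by the colours
      -- `1` to `K`: the child of colour `j` is sent to the port of that number.
      record Hub : Set where
        field
          centre   : V
          port     : Fin K → V
          centre~  : ∀ i → centre ~ port i
          port-inj : Injective _≡_ _≡_ port

      open Hub

      v₀ : V
      v₀ = fromℕ< (>-nonZero⁻¹ order {{nonempty}})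

      -- No child of a vertex v of R k has the colour of v, which therefore can
      -- serve as the number of the port leading back to the parent of v.
      hub : RVertex k → Hub
      hub root = let e , v₀~e , e-inj = numberNeighbours G v₀ (K≤deg v₀) in
        record { centre = v₀ ; port = e ; centre~ = v₀~e ; port-inj = e-inj }
      hub (child v j p) =
        let s = slot j (1≤j<k v p)
            b = port (hub v) s
            e , b~e , e-inj , _ = numberNeighboursWith G b (K≤deg b) s (~-sym (centre~ (hub v) s))
        in record { centre = b ; port = e ; centre~ = b~e ; port-inj = e-inj }

      f : RVertex k → V
      f = centre ∘ hub

      -- In either direction an edge is numbered by the colour of its child end. The edges at one
      -- vertex get distinct numbers because its children have distinct colours, all different from
      -- its own.
      slotTo : ∀ {v w : RVertex k} → v ~ᴿ w → Fin K
      slotTo (inj₁ (childOf {u} {j} {p})) = slot j (1≤j<k u p)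
      slotTo (inj₂ (childOf {u} {j} {p})) = slot j (1≤j<k u p)

      port-slotTo : ∀ {v w : RVertex k} (e : v ~ᴿ w) → port (hub v) (slotTo e) ≡ f w
      port-slotTo (inj₁ (childOf {u} {j} {p})) =
        let s = slot j (1≤j<k u p)
            b = port (hub u) s
        in proj₂ (proj₂ (proj₂ (numberNeighboursWith G b (K≤deg b) s (~-sym (centre~ (hub u) s)))))
      port-slotTo (inj₂ childOf) = refl

      slotTo-injective : ∀ {v w w′ : RVertex k} (e : v ~ᴿ w) (e′ : v ~ᴿ w′) →
                         slotTo e ≡ slotTo e′ → w ≡ w′
      slotTo-injective (inj₁ childOf) (inj₁ childOf) _ = refl
      slotTo-injective {v = v@(child u i p)} {w′ = child _ j q} (inj₁ childOf) (inj₂ childOf) eq =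
        contradiction (sym (slot-injective i j (1≤j<k u p) (1≤j<k v q) eq))
                      (proj₂ (child-colour v q))
      slotTo-injective {v = v@(child u i p)} {w = child _ j q} (inj₂ childOf) (inj₁ childOf) eq =
        contradiction (slot-injective j i (1≤j<k v q) (1≤j<k u p) eq) (proj₂ (child-colour v q))
      slotTo-injective {v} {child _ i p} {child _ j q} (inj₂ childOf) (inj₂ childOf) eq
        with refl ← slot-injective i j (1≤j<k v p) (1≤j<k v q) eq = refl

      f-~ : ∀ {v w} → v ~ᴿ w → f v ~ f w
      f-~ {v} e = subst (f v ~_) (port-slotTo e) (centre~ (hub v) (slotTo e))

      locallyInjective : ∀ {v w w′} → v ~ᴿ w → v ~ᴿ w′ → f w ≡ f w′ → w ≡ w′
      locallyInjective {v} e e′ eq = slotTo-injective e e′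
        (port-inj (hub v) (trans (port-slotTo e) (trans eq (sym (port-slotTo e′)))))

      mapPath : ∀ {v xs w} → Path _~ᴿ_ v xs w → Path _~_ (f v) (map f xs) (f w)
      mapPath []      = []
      mapPath (e ∷ p) = f-~ e ∷ mapPath p

      -- Two vertices two steps apart on a simple path are distinct neighbours of the one between
      -- them, so local injectivity separates their images.
      mapReduced : ∀ {v xs w} → Path _~ᴿ_ v xs w → Unique (v ∷ xs) → Reduced (map f (v ∷ xs))
      mapReduced []       _ = single
      mapReduced (_ ∷ []) _ = double
      mapReduced (e ∷ p@(e′ ∷ _)) ((_ ∷ v≢w ∷ _) ∷ u) =
        v≢w ∘ locallyInjective (swap e) e′ ∷ mapReduced p u

      f-injective : Injective _≡_ _≡_ f
      f-injective {v} {w} eq = decidable-stable (v ≟ᴿ w) distinct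
        where
        2≤k : 2 ≤ k
        2≤k = s≤s (s≤s z≤n)

        distinct : ¬ (v ≢ w)
        distinct v≢w
          with eraseLoops _≟ᴿ_ (toRoot 2≤k (position v) ++ʷ reverseʷ swap (toRoot 2≤k (position w)))
        ... | [] , [] , _ , _ = v≢w refl
        ... | xs@(_ ∷ _) , p , u , l
          with reduced⇒unique G ≤cycles (mapPath p) (mapReduced p u) short
          where
          short : length (map f xs) < 2 * k + 2
          short = ≤-trans (s≤s (≤-trans (≤-reflexive (length-map f xs)) l))
            (≤-trans (n≤1+n _) (≤-reflexive
              (solve 1 (λ x → con 2 :+ (x :+ x) := con 2 :* x :+ con 2) refl k)))
            where open +-*-Solver
        -- The image walk has distinct vertices and ends at `f w`, which therefore differs from its
        -- start `f v`.
        ...   | v∉ ∷ _ = All.lookup v∉ (end∈ (mapPath p)) eq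

    K≤δ⇒R⊑ : R k ⊑ simpleGraph
    K≤δ⇒R⊑ = f , f-injective , f-~

girth≤cycles : ∀ (G : Graph) {g n ℓ} → girth[ G ]≡ g → [ n ] ≤⁺ g → CycleOfLength G ℓ → n ≤ ℓ
girth≤cycles G (acyclic none) _ cycle = contradiction cycle (none _)
girth≤cycles G (shortest (_ , min)) n≤g cycle = ≤-trans ([≤]-injective n≤g) (min cycle)

theorem2 : (∀ (k : ℕ) (G : Graph) (g : ℕ ⁺) →
    3 ≤ k →
    m*[ G ]≡ (k ∸ 1) →
    girth[ G ]≡ g →
    [ 2 * k + 2 ] ≤⁺ g →
    R k ⊑ Graph.simpleGraph G →
    z[ G ]≡ k)
    ×
    (∀ (k : ℕ) (G : Graph) (g : ℕ ⁺) →
    3 ≤ k →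
    (k ∸ 3) * 2 ^ (k ∸ 1) + k + 2 ≤ Graph.order G →
    m*[ G ]≡ (k ∸ 1) →
    δ[ G ]≡ (k ∸ 1) →
    girth[ G ]≡ g →
    [ 2 * k + 2 ] ≤⁺ g →
    z[ G ]≡ k)
theorem2 =
  (λ { _ G _ (s≤s (s≤s (s≤s _))) m* girth 2k+2≤g →
       R⊑⇒z≡ G m* (girth≤cycles G girth 2k+2≤g) }) ,
  (λ { _ G _ (s≤s (s≤s (s≤s _))) _ m* (_ , min) girth 2k+2≤g →
       R⊑⇒z≡ G m* (girth≤cycles G girth 2k+2≤g)
         (K≤δ⇒R⊑ G (girth≤cycles G girth 2k+2≤g) λ v → min (v , refl)) })
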